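{- The frame property of coreflexivity is definable in $\mathcal{L}(\blacktriangle)$; that is, there is a set $\Gamma\subseteq\mathcal{L}(\blacktriangle)$ such that for every frame $\mathcal{F}=\langle S,R\rangle$, $R$ is coreflexive iff $\mathcal{F}\vDash\Gamma$.
   Context: Let $\mathbf{P}$ be a nonempty set of propositional variables. $\mathcal{L}(\blacktriangle)$-formulas: $\varphi::=\top\mid p\mid\neg\varphi\mid(\varphi\land\varphi)\mid\blacktriangle\varphi$ with $p\in\mathbf{P}$. A frame is $\mathcal{F}=\langle S,R\rangle$ with $S$ nonempty and $R\subseteq S\times S$; a model based on $\mathcal{F}$ is $\mathcal{M}=\langle S,R,V\rangle$ with $V:\mathbf{P}\to\mathcal{P}(S)$. Truth: $\top$, variables, $\neg,\land$ as usual; $\mathcal{M},s\vDash\blacktriangle\varphi$ iff (if $\mathcal{M},s\vDash\varphi$ then $\mathcal{M},t\vDash\varphi$ for all $t$ with $sRt$) and (if $\mathcal{M},s\nvDash\varphi$ then $\mathcal{M},t\nvDash\varphi$ for all $t$ with $sRt$). $\mathcal{F}\vDash\varphi$ means $\mathcal{M},s\vDash\varphi$ for every model $\mathcal{M}$ based on $\mathcal{F}$ and every $s\in S$; $\mathcal{F}\vDash\Gamma$ means $\mathcal{F}\vDash\varphi$ for all $\varphi\in\Gamma$. $R$ is coreflexive if for all $s,t\in S$, $sRt$ implies $s=t$. -}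

module Defs where

open import Data.Product using (_×_)
open import Data.Unit.Polymorphic using (⊤)
open import Level using (Level; _⊔_) renaming (suc to lsuc)
open import Relation.Binary using (Rel)
open import Relation.Binary.PropositionalEquality using (_≡_)
open import Relation.Nullary using (¬_)
open import Relation.Unary using (Pred; _∈_)

private
  variable
    p ℓ γ : Level
    P : Set p

infix  30 ∼_ ▲_
infixr 25 _∧_

data Formula (P : Set p) : Set p where
  top : Formula P
  var : P → Formula P
  ∼_  : Formula P → Formula P
  _∧_ : Formula P → Formula P → Formula P
  ▲_  : Formula P → Formula P

record Frame (ℓ : Level) : Set (lsuc ℓ) where
  field
    S        : Set ℓ
    R        : Rel S ℓ
    nonempty : S

-- Subsets of S are arbitrary predicates at the level of S, with no
-- decidability assumption.
record Model (P : Set p) (F : Frame ℓ) : Set (p ⊔ lsuc ℓ) where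
  open Frame F
  field
    V : P → Pred S ℓ

infix 4 _,_⊨_ _⊨ᶠ_ _⊨ˢ_

_,_⊨_ : {F : Frame ℓ} → Model P F → Frame.S F → Formula P → Set ℓ
M , s ⊨ top     = ⊤
M , s ⊨ var x   = s ∈ Model.V M x
M , s ⊨ ∼ φ     = ¬ (M , s ⊨ φ)
M , s ⊨ φ ∧ ψ   = (M , s ⊨ φ) × (M , s ⊨ ψ)
_,_⊨_ {F = F} M s (▲ φ) =
    (M , s ⊨ φ → ∀ t → R s t → M , t ⊨ φ)
  × (¬ (M , s ⊨ φ) → ∀ t → R s t → ¬ (M , t ⊨ φ))
  where open Frame F

_⊨ᶠ_ : {P : Set p} → Frame ℓ → Formula P → Set (p ⊔ lsuc ℓ)
_⊨ᶠ_ {P = P} F φ = (M : Model P F) (s : Frame.S F) → M , s ⊨ φ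

_⊨ˢ_ : {P : Set p} → Frame ℓ → Pred (Formula P) γ → Set (p ⊔ lsuc ℓ ⊔ γ)
F ⊨ˢ Γ = ∀ φ → φ ∈ Γ → F ⊨ᶠ φ

Coreflexive : {A : Set ℓ} → Rel A ℓ → Set ℓ
Coreflexive R = ∀ s t → R s t → s ≡ t

module Submission where

open import Defs
open import Data.Product using (Σ-syntax; _,_; proj₁)
open import Function.Bundles using (_⇔_; mk⇔)
open import Level using (Level)
open import Relation.Binary.PropositionalEquality using (refl)
open import Relation.Unary using (Pred; ｛_｝)

private
  variable
    p ℓ : Level
    P : Set p

-- The single formula `▲ var x` defines coreflexivity. If each state sees at most itself, no truth
-- value changes along `R`, so every `▲ φ` is valid. Conversely, make `x` true at `s` alone:
-- validity carries it to every successor of `s`, which must then be `s`.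

coreflexive⇒⊨▲ : (F : Frame ℓ) (φ : Formula P) → Coreflexive (Frame.R F) → F ⊨ᶠ ▲ φ
coreflexive⇒⊨▲ F φ corefl M s = preserves , reflects
  where
  open Frame F

  preserves : M , s ⊨ φ → ∀ t → R s t → M , t ⊨ φ
  preserves h t r with refl ← corefl s t r = h

  reflects : M , s ⊨ ∼ φ → ∀ t → R s t → M , t ⊨ ∼ φ
  reflects h t r with refl ← corefl s t r = h

-- Evaluate ▲ x at s with every variable true exactly at s.
⊨▲var⇒coreflexive : (F : Frame ℓ) (x : P) → F ⊨ᶠ ▲ var x → Coreflexive (Frame.R F)
-- `refl` proves `var x` at `s`; the truth of `var x` at a successor `t` is by definition `s ≡ t`.
⊨▲var⇒coreflexive F x valid s = proj₁ (valid (record { V = λ _ → ｛ s ｝ }) s) refl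

proposition21 : {p ℓ : Level} (P : Set p) → P →
    Σ[ Γ ∈ Pred (Formula P) p ] ((F : Frame ℓ) → Coreflexive (Frame.R F) ⇔ F ⊨ˢ Γ)
proposition21 P x = ｛ ▲ var x ｝ , λ F → mk⇔
  (λ { corefl _ refl → coreflexive⇒⊨▲ F (var x) corefl })
  (λ valid → ⊨▲var⇒coreflexive F x (valid (▲ var x) refl))
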